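{- The Matroid Intersection Cover (MIC) problem admits no EPTAS, unless $\mathrm{W}[1]=\mathrm{FPT}$.
   Context: An instance of Matroid Intersection Cover (MIC) consists of two matroids $\mathcal{M}_1=(E,\mathcal{I}_1)$ and $\mathcal{M}_2=(E,\mathcal{I}_2)$ on the same finite ground set $E$ (accessed through independence oracles), functions $v,w:E\to\mathbb{R}_{\ge0}$ (rational-valued for encoding purposes) and a threshold $L\ge0$. A feasible solution is a set $S\in\mathcal{I}_1\cap\mathcal{I}_2$ with $w(S)=\sum_{e\in S}w(e)\ge L$; the goal is to find a feasible solution minimizing $v(S)=\sum_{e\in S}v(e)$; $\mathrm{OPT}$ denotes the minimum. An EPTAS for MIC is an algorithm which, given $\varepsilon>0$ and an instance having a feasible solution, outputs a feasible solution $S$ with $v(S)\le(1+\varepsilon)\,\mathrm{OPT}$, in time (counting each oracle query as one step) $g(1/\varepsilon)\cdot m^{O(1)}$, where $g$ is a computable function and $m$ is the instance size. $\mathrm{FPT}$ and $\mathrm{W}[1]$ are the standard parameterized complexity classes. -}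

module Defs where

open import Data.Bool.Base using (Bool; true; false; if_then_else_; not)
open import Data.Bool.ListAction using (all; any)
open import Data.Fin.Base using (Fin; zero; suc; toℕ)
open import Data.Fin.Subset using (Subset; _∈_; _∉_; _⊆_; _∪_; ⁅_⁆; ∣_∣; ⊥)
open import Data.Integer.Base as ℤ using (ℤ; +_; -[1+_])
open import Data.List.Base as List using (List; []; _∷_; _++_; [_]; length; replicate)
open import Data.List.Extrema.Nat using (max)
open import Data.Maybe.Base using (Maybe; just; nothing)
open import Data.Nat.Base using (ℕ; zero; suc; _+_; _*_; _^_; _≤_; _<_; _<ᵇ_)
open import Data.Nat.Binary.Base as ℕᵇ using (ℕᵇ; 2[1+_]; 1+[2_])
import Data.Nat.Properties as ℕ
open import Data.Product.Base using (Σ; ∃-syntax; _×_; _,_; proj₂)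
open import Data.Rational.Base as ℚ using (ℚ; 0ℚ; 1ℚ; 1/_; ↥_; ↧ₙ_)
open import Data.Rational.Properties using (pos⇒nonZero)
open import Data.Vec.Base as Vec using (Vec; []; _∷_; lookup; toList; fromList)
open import Algebra.Definitions.RawMonoid ℚ.+-0-rawMonoid using (sum)
open import Function.Bundles using (_⇔_)
open import Level using (0ℓ)
open import Relation.Binary.PropositionalEquality using (_≡_; subst)
open import Relation.Nullary.Decidable using (yes; no; ⌊_⌋)
open import Relation.Unary using (Pred; Decidable)

------------------------------------------------------------------------
-- Deterministic multi-tape oracle Turing machines

Word : Set
Word = List Bool

Symbol : Set
Symbol = Maybe Bool        -- nothing is the blank

-- A two-way infinite tape: cells outside the two lists are blank, and
-- `left` is listed starting from the cell next to the head.
record Tape : Set where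
  constructor tape
  field
    left  : List Symbol
    head  : Symbol
    right : List Symbol

data Direction : Set where
  left stay right : Direction

blankTape : Tape
blankTape = tape [] nothing []

inputTape : Word → Tape
inputTape []       = blankTape
inputTape (b ∷ bs) = tape [] (just b) (List.map just bs)

move : Direction → Tape → Tape
move left  (tape []       s rs)       = tape [] nothing (s ∷ rs)
move left  (tape (l ∷ ls) s rs)       = tape ls l (s ∷ rs)
move stay  t                          = t
move right (tape ls       s [])       = tape (s ∷ ls) nothing []
move right (tape ls       s (r ∷ rs)) = tape (s ∷ ls) r rs

writeMove : Symbol × Direction → Tape → Tape
writeMove (s , d) (tape ls _ rs) = move d (tape ls s rs)

untilBlank : List Symbol → Word
untilBlank []             = []
untilBlank (nothing ∷ _)  = []
untilBlank (just b ∷ ss)  = b ∷ untilBlank ss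

-- Queries and outputs are read from the head rightwards up to the
-- first blank.
wordAtHead : Tape → Word
wordAtHead (tape _ s rs) = untilBlank (s ∷ rs)

-- `ask j i p q` submits the word at the head of tape i to oracle j and
-- passes to state p or q according to the answer.
data Action (oracles states tapes : ℕ) : Set where
  halt : Action oracles states tapes
  step : Fin states → Vec (Symbol × Direction) tapes → Action oracles states tapes
  ask  : Fin oracles → Fin tapes → Fin states → Fin states → Action oracles states tapes

-- The first tape carries the input and, on halting, the output.
record Machine (oracles : ℕ) : Set where
  field
    states    : ℕ
    workTapes : ℕ
    start     : Fin states
    δ         : Fin states → Vec Symbol (suc workTapes) →
                Action oracles states (suc workTapes)

Oracles : ℕ → Set
Oracles o = Fin o → Word → Bool

module _ {o : ℕ} (M : Machine o) (O : Oracles o) where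
  open Machine M

  -- The output if M halts within the given number of steps; an oracle
  -- query is a single step.
  run : ℕ → Fin states → Vec Tape (suc workTapes) → Maybe Word
  run t q ts with δ q (Vec.map Tape.head ts)
  run t       q ts | halt        = just (wordAtHead (Vec.head ts))
  run zero    q ts | step _ _    = nothing
  run zero    q ts | ask _ _ _ _ = nothing
  run (suc t) q ts | step q′ as  = run t q′ (Vec.zipWith writeMove as ts)
  run (suc t) q ts | ask j i p r =
    run t (if O j (wordAtHead (lookup ts i)) then p else r) ts

  Outputs : Word → ℕ → Word → Set
  Outputs x t y =
    run t start (inputTape x ∷ Vec.replicate workTapes blankTape) ≡ just y

noOracles : Oracles 0
noOracles ()

------------------------------------------------------------------------
-- Encodings

unary : ℕ → Word
unary k = replicate k true ++ [ false ]

encodeℕᵇ : ℕᵇ → Word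
encodeℕᵇ ℕᵇ.zero   = false ∷ []
encodeℕᵇ 2[1+ x ]  = true ∷ true ∷ encodeℕᵇ x
encodeℕᵇ 1+[2 x ]  = true ∷ false ∷ encodeℕᵇ x

-- Self-delimiting, of length logarithmic in the number.
encodeℕ : ℕ → Word
encodeℕ n = encodeℕᵇ (ℕᵇ.fromℕ n)

encodeℤ : ℤ → Word
encodeℤ (+ n)    = false ∷ encodeℕ n
encodeℤ -[1+ n ] = true ∷ encodeℕ n

encodeℚ : ℚ → Word
encodeℚ p = encodeℤ (↥ p) ++ encodeℕ (↧ₙ p)

Computable : {A B : Set} → (A → Word) → (B → Word) → (A → B) → Set
Computable encA encB f =
  Σ (Machine 0) λ M → ∀ a → ∃[ t ] Outputs M noOracles (encA a) t (encB (f a))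

------------------------------------------------------------------------
-- Parameterized problems and FPT

ParamInstance : Set
ParamInstance = Word × ℕ

ParamProblem : Set₁
ParamProblem = Pred ParamInstance 0ℓ

-- Both components count towards the size, and the parameter is written
-- in unary.
encodeParam : ParamInstance → Word
encodeParam (x , k) = unary k ++ x

-- f(k) · |(x,k)|ᶜ
paramTime : (ℕ → ℕ) → ℕ → ParamInstance → ℕ
paramTime f c (x , k) = f k * length (encodeParam (x , k)) ^ c

record FPT (Q : ParamProblem) : Set where
  field
    machine      : Machine 0
    f            : ℕ → ℕ
    f-computable : Computable encodeℕ encodeℕ f
    c            : ℕ
    decides      : ∀ p → Σ Bool λ b →
                   Outputs machine noOracles (encodeParam p) (paramTime f c p) [ b ]
                   × (b ≡ true ⇔ Q p)

record _≤fpt_ (Q R : ParamProblem) : Set where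
  field
    machine      : Machine 0
    f g          : ℕ → ℕ
    f-computable : Computable encodeℕ encodeℕ f
    g-computable : Computable encodeℕ encodeℕ g
    c            : ℕ
    reduces      : ∀ p → ∃[ p′ ]
                   Outputs machine noOracles (encodeParam p) (paramTime f c p)
                           (encodeParam p′)
                   × proj₂ p′ ≤ g (proj₂ p)
                   × (Q p ⇔ R p′)

------------------------------------------------------------------------
-- Boolean circuits and the W-hierarchy

-- A gate reading from m earlier nodes; ∧ and ∨ have fan-in at least two.
data Gate (m : ℕ) : Set where
  ¬-gate : Fin m → Gate m
  ∧-gate : ∀ {a} → Vec (Fin m) (2 + a) → Gate m
  ∨-gate : ∀ {a} → Vec (Fin m) (2 + a) → Gate m

-- The nodes of a circuit with n inputs, in topological order.  Among m
-- nodes, `zero : Fin m` refers to the one added last.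
data Nodes (n : ℕ) : ℕ → Set where
  inputs : Nodes n n
  _▷_    : ∀ {m} → Nodes n m → Gate m → Nodes n (suc m)

record Circuit : Set where
  field
    {arity size} : ℕ
    nodes        : Nodes arity size
    output       : Fin size

predecessors : ∀ {m} → Gate m → List (Fin m)
predecessors (¬-gate i)  = [ i ]
predecessors (∧-gate is) = toList is
predecessors (∨-gate is) = toList is

nodeDepth : ∀ {n m} → Nodes n m → Fin m → ℕ
nodeDepth inputs  _       = 0
nodeDepth (C ▷ g) zero    = suc (max 0 (List.map (nodeDepth C) (predecessors g)))
nodeDepth (C ▷ g) (suc i) = nodeDepth C i

-- 1 for large gates, i.e. those of fan-in greater than two.
largeness : ∀ {m} → Gate m → ℕ
largeness g = if 2 <ᵇ length (predecessors g) then 1 else 0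

nodeWeft : ∀ {n m} → Nodes n m → Fin m → ℕ
nodeWeft inputs  _       = 0
nodeWeft (C ▷ g) zero    =
  largeness g + max 0 (List.map (nodeWeft C) (predecessors g))
nodeWeft (C ▷ g) (suc i) = nodeWeft C i

-- An assignment is the set of inputs that are true.
nodeValue : ∀ {n m} → Nodes n m → Subset n → Fin m → Bool
nodeValue inputs              a i       = lookup a i
nodeValue (C ▷ ¬-gate i)      a zero    = not (nodeValue C a i)
nodeValue (C ▷ ∧-gate is)     a zero    = all (nodeValue C a) (toList is)
nodeValue (C ▷ ∨-gate is)     a zero    = any (nodeValue C a) (toList is)
nodeValue (C ▷ _)             a (suc i) = nodeValue C a i

depth weft : Circuit → ℕ
depth C = nodeDepth (Circuit.nodes C) (Circuit.output C)
weft  C = nodeWeft  (Circuit.nodes C) (Circuit.output C)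

encodeFin : ∀ {m} → Fin m → Word
encodeFin i = encodeℕ (toℕ i)

encodeFins : ∀ {m a} → Vec (Fin m) a → Word
encodeFins {a = a} is = encodeℕ a ++ List.concatMap encodeFin (toList is)

encodeGate : ∀ {m} → Gate m → Word
encodeGate (¬-gate i)  = false ∷ encodeFin i
encodeGate (∧-gate is) = true ∷ false ∷ encodeFins is
encodeGate (∨-gate is) = true ∷ true ∷ encodeFins is

encodeNodes : ∀ {n m} → Nodes n m → Word
encodeNodes {n} inputs = unary n
encodeNodes (C ▷ g)    = encodeNodes C ++ true ∷ encodeGate g

encodeCircuit : Circuit → Word
encodeCircuit C = encodeNodes (Circuit.nodes C) ++ false ∷ encodeFin (Circuit.output C)

HasSatisfyingAssignmentOfWeight : Circuit → ℕ → Set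
HasSatisfyingAssignmentOfWeight C k = ∃[ a ] ∣ a ∣ ≡ k × nodeValue nodes a output ≡ true
  where open Circuit C

-- Words that do not encode a circuit of the class are no-instances.
WeightedCircuitSat : (t d : ℕ) → ParamProblem
WeightedCircuitSat t d (x , k) =
  ∃[ C ] x ≡ encodeCircuit C × weft C ≤ t × depth C ≤ d
         × HasSatisfyingAssignmentOfWeight C k

W[_] : ℕ → Pred ParamProblem 0ℓ
W[ t ] Q = ∃[ d ] Q ≤fpt WeightedCircuitSat t d

------------------------------------------------------------------------
-- Matroid Intersection Cover

record Matroid (n : ℕ) : Set₁ where
  field
    Independent  : Pred (Subset n) 0ℓ
    independent? : Decidable Independent
    empty        : Independent ⊥
    hereditary   : ∀ {A B} → A ⊆ B → Independent B → Independent A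
    exchange     : ∀ {A B} → Independent A → Independent B → ∣ A ∣ < ∣ B ∣ →
                   ∃[ e ] e ∈ B × e ∉ A × Independent (A ∪ ⁅ e ⁆)

-- The query word is read as a characteristic vector; words of the wrong
-- length are answered negatively.
independenceOracle : ∀ {n} → Matroid n → Word → Bool
independenceOracle {n} M x with length x ℕ.≟ n
... | yes eq = ⌊ Matroid.independent? M (subst Subset eq (fromList x)) ⌋
... | no  _  = false

record Instance : Set₁ where
  field
    n      : ℕ
    M₁ M₂  : Matroid n
    v w    : Fin n → ℚ
    v-nonNeg : ∀ e → 0ℚ ℚ.≤ v e
    w-nonNeg : ∀ e → 0ℚ ℚ.≤ w e
    L        : ℚ
    L-nonNeg : 0ℚ ℚ.≤ L

total : ∀ {n} → (Fin n → ℚ) → Subset n → ℚ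
total h S = sum λ e → if lookup S e then h e else 0ℚ

module _ (I : Instance) where
  open Instance I

  Feasible : Pred (Subset n) 0ℓ
  Feasible S = Matroid.Independent M₁ S × Matroid.Independent M₂ S × L ℚ.≤ total w S

  IsOPT : Pred ℚ 0ℓ
  IsOPT opt = (∃[ S ] Feasible S × total v S ≡ opt) × (∀ S → Feasible S → opt ℚ.≤ total v S)

  -- The matroids are given by the oracles only.
  encodeInstance : Word
  encodeInstance =
    encodeℕ n
    ++ List.concat (List.tabulate λ e → encodeℚ (v e) ++ encodeℚ (w e))
    ++ encodeℚ L

  instanceOracles : Oracles 2
  instanceOracles zero    = independenceOracle M₁
  instanceOracles (suc _) = independenceOracle M₂

-- The solution is output as its characteristic vector.  OPT exists
-- exactly when some feasible solution does.
record MIC-EPTAS : Set₁ where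
  field
    machine      : Machine 2
    g            : ℚ → ℕ
    g-computable : Computable encodeℚ encodeℕ g
    c            : ℕ
    approximates :
      ∀ (ε : ℚ) .{{_ : ℚ.Positive ε}} (I : Instance) (opt : ℚ) → IsOPT I opt →
      ∃[ S ] Outputs machine (instanceOracles I)
                     (encodeℚ ε ++ encodeInstance I)
                     (g ((1/ ε) {{pos⇒nonZero ε}}) * length (encodeInstance I) ^ c)
                     (toList S)
             × Feasible I S
             × total (Instance.v I) S ℚ.≤ (1ℚ ℚ.+ ε) ℚ.* opt

-- The hypothesis is refutable outright, because matroids given by oracles
-- can hide a solution.  Take m pairs {aᵢ , bᵢ}, with v = 1, w = 2 on the aᵢ
-- and v = 0, w = 1 on the bᵢ, and L = m + k.  Let M₂ allow at most one
-- element of each pair.  Then a solution costs at least k, and one of cost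
-- k is a transversal of the pairs with exactly k elements aᵢ.  Any two such
-- transversals differ by more than one exchange, so declaring all of them
-- but one to be dependent leaves a sparse paving matroid M₁.  For ε < 1/k an
-- EPTAS must output the remaining transversal; but as long as it has not
-- queried it, every other unqueried one could be the remaining one as well.
-- With k above the exponent of the running time, there are more transversals
-- than steps once m is large.
module Submission where

open import Defs
open import Data.Bool.Base using (Bool; true; false; if_then_else_)
import Data.Bool.Properties as Bool
open import Data.Empty using (⊥-elim)
open import Data.Fin.Base as Fin using (Fin; zero; suc; _↑ˡ_; _↑ʳ_; remQuot; combine)
import Data.Fin.Properties as Fin
open import Data.Fin.Subset using (Subset; _∈_; _∉_; _⊆_; _∪_; ⁅_⁆; ∣_∣; ⊥; ∁)
open import Data.Fin.Subset.Properties
open import Data.Integer.Base as ℤ using ()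
import Data.Integer.Properties as ℤ
open import Data.List.Base as List using (List; []; _∷_; length; fromMaybe)
import Data.List.Properties as List
open import Data.List.Membership.DecPropositional (List.≡-dec Bool._≟_)
  using () renaming (_∈_ to _List∈_; _∉_ to _List∉_; _∈?_ to _∈ʷ?_)
open import Data.List.Membership.Propositional.Properties using (∈-++⁺ˡ; ∈-++⁺ʳ)
open import Data.List.Relation.Unary.Any as Any using (here; there)
open import Data.List.Relation.Unary.Any.Properties using (lookup-index)
open import Data.Maybe.Base using (just; nothing)
open import Data.Nat.Base
open import Data.Nat.Properties
open import Data.Nat.Binary.Base as ℕᵇ using (2[1+_]; 1+[2_])
open import Data.Nat.Binary.Properties using (fromℕ≡fromℕ')
import Data.Nat.Coprimality as Coprime
open import Data.Nat.Tactic.RingSolver using (solve-∀)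
open import Data.Product.Base using (∃-syntax; _×_; _,_; proj₁; proj₂)
open import Data.Rational.Base as ℚ using (ℚ; mkℚ; 1ℚ; 1/_)
import Data.Rational.Properties as ℚ
import Data.Rational.Unnormalised.Base as ℚᵘ
import Data.Rational.Unnormalised.Properties as ℚᵘ
open import Data.Sum.Base using (inj₁; inj₂; [_,_]′)
open import Data.Vec.Base as Vec using (Vec; []; _∷_; _++_; lookup; take; drop; toList; fromList)
import Data.Vec.Properties as Vec
open import Function.Base using (_∘_)
open import Function.Bundles using (_⇔_; mk⇔; Equivalence)
open import Level using (0ℓ)
open import Relation.Binary.PropositionalEquality
open import Relation.Nullary using (Dec; ¬_; contradiction; yes; no)
open import Relation.Nullary.Decidable using (_×-dec_; _→-dec_; ¬?; isYes≗does; does-⇔)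
open import Relation.Unary using (Pred; Decidable; _≐_)

-- Cardinalities of finite subsets; disjointness is written `p ⊆ ∁ q`

⊈⇒∃∈∉ : ∀ {n} {p q : Subset n} → ¬ (q ⊆ p) → ∃[ x ] x ∈ q × x ∉ p
⊈⇒∃∈∉ {n} {p} {q} q⊈p
  with Fin.¬∀⟶∃¬ n (λ x → x ∈ q → x ∈ p) (λ x → (x ∈? q) →-dec (x ∈? p)) (λ q⊆p → q⊈p (q⊆p _))
... | x , ¬imp with x ∈? q
... | yes x∈q = x , x∈q , λ x∈p → ¬imp (λ _ → x∈p)
... | no  x∉q = contradiction (λ x∈q → contradiction x∈q x∉q) ¬imp

∣p∣<∣q∣⇒∃∈∉ : ∀ {n} {p q : Subset n} → ∣ p ∣ < ∣ q ∣ → ∃[ x ] x ∈ q × x ∉ p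
∣p∣<∣q∣⇒∃∈∉ p<q = ⊈⇒∃∈∉ (<⇒≱ p<q ∘ p⊆q⇒∣p∣≤∣q∣)

⊆∧∣q∣≤∣p∣⇒≡ : ∀ {n} {p q : Subset n} → p ⊆ q → ∣ q ∣ ≤ ∣ p ∣ → p ≡ q
⊆∧∣q∣≤∣p∣⇒≡ {p = p} {q} p⊆q q≤p with q ⊆? p
... | yes q⊆p = ⊆-antisym p⊆q q⊆p
... | no  q⊈p = contradiction q≤p (<⇒≱ (p⊂q⇒∣p∣<∣q∣ (p⊆q , ⊈⇒∃∈∉ q⊈p)))

∣p∪q∣≤∣p∣+∣q∣ : ∀ {n} (p q : Subset n) → ∣ p ∪ q ∣ ≤ ∣ p ∣ + ∣ q ∣
∣p∪q∣≤∣p∣+∣q∣ []          []          = z≤n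
∣p∪q∣≤∣p∣+∣q∣ (false ∷ p) (false ∷ q) = ∣p∪q∣≤∣p∣+∣q∣ p q
∣p∪q∣≤∣p∣+∣q∣ (false ∷ p) (true ∷ q)  =
  ≤-trans (s≤s (∣p∪q∣≤∣p∣+∣q∣ p q)) (≤-reflexive (sym (+-suc ∣ p ∣ ∣ q ∣)))
∣p∪q∣≤∣p∣+∣q∣ (true ∷ p)  (false ∷ q) = s≤s (∣p∪q∣≤∣p∣+∣q∣ p q)
∣p∪q∣≤∣p∣+∣q∣ (true ∷ p)  (true ∷ q)  =
  s≤s (≤-trans (∣p∪q∣≤∣p∣+∣q∣ p q) (+-monoʳ-≤ ∣ p ∣ (n≤1+n _)))

∣p∪⁅x⁆∣≤1+∣p∣ : ∀ {n} (p : Subset n) x → ∣ p ∪ ⁅ x ⁆ ∣ ≤ suc ∣ p ∣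
∣p∪⁅x⁆∣≤1+∣p∣ p x = begin
  ∣ p ∪ ⁅ x ⁆ ∣      ≤⟨ ∣p∪q∣≤∣p∣+∣q∣ p ⁅ x ⁆ ⟩
  ∣ p ∣ + ∣ ⁅ x ⁆ ∣  ≡⟨ cong (_+_ ∣ p ∣) (∣⁅x⁆∣≡1 x) ⟩
  ∣ p ∣ + 1          ≡⟨ +-comm ∣ p ∣ 1 ⟩
  suc ∣ p ∣          ∎
  where open ≤-Reasoning

x∉p⇒∣p∪⁅x⁆∣≡1+∣p∣ : ∀ {n} (p : Subset n) x → x ∉ p → ∣ p ∪ ⁅ x ⁆ ∣ ≡ suc ∣ p ∣
x∉p⇒∣p∪⁅x⁆∣≡1+∣p∣ p x x∉p = ≤-antisym (∣p∪⁅x⁆∣≤1+∣p∣ p x)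
  (p⊂q⇒∣p∣<∣q∣ (p⊆p∪q ⁅ x ⁆ , x , q⊆p∪q p ⁅ x ⁆ (x∈⁅x⁆ x) , x∉p))

∪⁅⁆-injective : ∀ {n} {p : Subset n} {x y} → x ∉ p → p ∪ ⁅ x ⁆ ≡ p ∪ ⁅ y ⁆ → x ≡ y
∪⁅⁆-injective {p = p} {x} {y} x∉p eq
  with x∈p∪q⁻ p ⁅ y ⁆ (subst (x ∈_) eq (q⊆p∪q p ⁅ x ⁆ (x∈⁅x⁆ x)))
... | inj₁ x∈p = contradiction x∈p x∉p
... | inj₂ x∈y = x∈⁅y⁆⇒x≡y y x∈y

p⊆∁q⇒∣p∣+∣q∣≤n : ∀ {n} {p q : Subset n} → p ⊆ ∁ q → ∣ p ∣ + ∣ q ∣ ≤ n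
p⊆∁q⇒∣p∣+∣q∣≤n {n} {p} {q} p⊆∁q = begin
  ∣ p ∣ + ∣ q ∣        ≤⟨ +-monoˡ-≤ ∣ q ∣ (p⊆q⇒∣p∣≤∣q∣ p⊆∁q) ⟩
  ∣ ∁ q ∣ + ∣ q ∣      ≡⟨ cong (_+ ∣ q ∣) (∣∁p∣≡n∸∣p∣ q) ⟩
  n ∸ ∣ q ∣ + ∣ q ∣    ≡⟨ m∸n+n≡m (∣p∣≤n q) ⟩
  n                    ∎
  where open ≤-Reasoning

p⊆∁q⇒∣p∪q∣≡∣p∣+∣q∣ : ∀ {n} {p q : Subset n} → p ⊆ ∁ q → ∣ p ∪ q ∣ ≡ ∣ p ∣ + ∣ q ∣
p⊆∁q⇒∣p∪q∣≡∣p∣+∣q∣ {p = []}        {[]}        _ = refl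
p⊆∁q⇒∣p∪q∣≡∣p∣+∣q∣ {p = false ∷ p} {false ∷ q} d = p⊆∁q⇒∣p∪q∣≡∣p∣+∣q∣ (drop-∷-⊆ d)
p⊆∁q⇒∣p∪q∣≡∣p∣+∣q∣ {p = false ∷ p} {true ∷ q}  d =
  trans (cong suc (p⊆∁q⇒∣p∪q∣≡∣p∣+∣q∣ (drop-∷-⊆ d))) (sym (+-suc ∣ p ∣ ∣ q ∣))
p⊆∁q⇒∣p∪q∣≡∣p∣+∣q∣ {p = true ∷ p}  {false ∷ q} d = cong suc (p⊆∁q⇒∣p∪q∣≡∣p∣+∣q∣ (drop-∷-⊆ d))
p⊆∁q⇒∣p∪q∣≡∣p∣+∣q∣ {p = true ∷ p}  {true ∷ q}  d with d Vec.here
... | ()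

∁-injective : ∀ {n} {p q : Subset n} → ∁ p ≡ ∁ q → p ≡ q
∁-injective eq = ⊆-antisym (∁p⊆∁q⇒p⊇q (⊆-reflexive (sym eq))) (∁p⊆∁q⇒p⊇q (⊆-reflexive eq))

-- Subsets of a disjoint union, as concatenated characteristic vectors

∣++∣ : ∀ {m n} (p : Subset m) (q : Subset n) → ∣ p ++ q ∣ ≡ ∣ p ∣ + ∣ q ∣
∣++∣ []          q = refl
∣++∣ (false ∷ p) q = ∣++∣ p q
∣++∣ (true ∷ p)  q = cong suc (∣++∣ p q)

⊥-++ : ∀ m n → ⊥ {m + n} ≡ ⊥ {m} ++ ⊥ {n}
⊥-++ zero    n = refl
⊥-++ (suc m) n = cong (false ∷_) (⊥-++ m n)

⁅↑ˡ⁆ : ∀ {m} (i : Fin m) n → ⁅ i ↑ˡ n ⁆ ≡ ⁅ i ⁆ ++ ⊥ {n}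
⁅↑ˡ⁆ {suc m} zero    n = cong (true ∷_) (⊥-++ m n)
⁅↑ˡ⁆         (suc i) n = cong (false ∷_) (⁅↑ˡ⁆ i n)

⁅↑ʳ⁆ : ∀ m {n} (i : Fin n) → ⁅ m ↑ʳ i ⁆ ≡ ⊥ {m} ++ ⁅ i ⁆
⁅↑ʳ⁆ zero    i = refl
⁅↑ʳ⁆ (suc m) i = cong (false ∷_) (⁅↑ʳ⁆ m i)

++-∪-⁅↑ˡ⁆ : ∀ {m n} (p : Subset m) (q : Subset n) i →
            (p ++ q) ∪ ⁅ i ↑ˡ n ⁆ ≡ (p ∪ ⁅ i ⁆) ++ q
++-∪-⁅↑ˡ⁆ {n = n} p q i rewrite ⁅↑ˡ⁆ i n =
  trans (Vec.zipWith-++ _ p q ⁅ i ⁆ ⊥) (cong ((p ∪ ⁅ i ⁆) ++_) (∪-identityʳ q))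

++-∪-⁅↑ʳ⁆ : ∀ {m n} (p : Subset m) (q : Subset n) i →
            (p ++ q) ∪ ⁅ m ↑ʳ i ⁆ ≡ p ++ (q ∪ ⁅ i ⁆)
++-∪-⁅↑ʳ⁆ {m} p q i rewrite ⁅↑ʳ⁆ m i =
  trans (Vec.zipWith-++ _ p q ⊥ ⁅ i ⁆) (cong (_++ (q ∪ ⁅ i ⁆)) (∪-identityʳ p))

↑ˡ∈++⁺ : ∀ {m n} {p : Subset m} (q : Subset n) {i} → i ∈ p → i ↑ˡ n ∈ p ++ q
↑ˡ∈++⁺ {p = p} q {i} i∈p =
  Vec.lookup⇒[]= _ _ (trans (Vec.lookup-++ˡ p q i) (Vec.[]=⇒lookup i∈p))

↑ˡ∈++⁻ : ∀ {m n} {p : Subset m} (q : Subset n) {i} → i ↑ˡ n ∈ p ++ q → i ∈ p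
↑ˡ∈++⁻ {p = p} q {i} i∈ =
  Vec.lookup⇒[]= _ _ (trans (sym (Vec.lookup-++ˡ p q i)) (Vec.[]=⇒lookup i∈))

↑ʳ∈++⁺ : ∀ {m n} (p : Subset m) {q : Subset n} {i} → i ∈ q → m ↑ʳ i ∈ p ++ q
↑ʳ∈++⁺ p {q} {i} i∈q =
  Vec.lookup⇒[]= _ _ (trans (Vec.lookup-++ʳ p q i) (Vec.[]=⇒lookup i∈q))

↑ʳ∈++⁻ : ∀ {m n} (p : Subset m) {q : Subset n} {i} → m ↑ʳ i ∈ p ++ q → i ∈ q
↑ʳ∈++⁻ p {q} {i} i∈ =
  Vec.lookup⇒[]= _ _ (trans (sym (Vec.lookup-++ʳ p q i)) (Vec.[]=⇒lookup i∈))

take-drop-++ : ∀ {A : Set} {m n} (xs : Vec A m) (ys : Vec A n) →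
               take m (xs ++ ys) ≡ xs × drop m (xs ++ ys) ≡ ys
take-drop-++ {m = m} xs ys =
  Vec.++-injective (take m (xs ++ ys)) xs (Vec.take++drop≡id m (xs ++ ys))

++-view : ∀ {A : Set} m {n} (zs : Vec A (m + n)) →
          ∃[ xs ] ∃[ ys ] zs ≡ xs ++ ys
++-view m zs = take m zs , drop m zs , sym (Vec.take++drop≡id m zs)

data SplitFin m n : Fin (m + n) → Set where
  onLeft  : (i : Fin m) → SplitFin m n (i ↑ˡ n)
  onRight : (j : Fin n) → SplitFin m n (m ↑ʳ j)

splitFin : ∀ m n i → SplitFin m n i
splitFin m n i = subst (SplitFin m n) (Fin.join-splitAt m n i) (view (Fin.splitAt m i))
  where
  view : ∀ s → SplitFin m n (Fin.join m n s)
  view (inj₁ i) = onLeft i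
  view (inj₂ j) = onRight j

-- Sparse paving and partition matroids

module _ {n} (r : ℕ) (0<r : 0 < r) (Bad : Pred (Subset n) 0ℓ) (bad? : Decidable Bad)
         (∣bad∣ : ∀ {A} → Bad A → ∣ A ∣ ≡ r)
         (separated : ∀ {A e f} → e ∉ A → f ∉ A → Bad (A ∪ ⁅ e ⁆) → Bad (A ∪ ⁅ f ⁆) → e ≡ f)
         where

  -- The bad sets are `r`-sets no two of which differ by a single exchange. Forbidding them among
  -- the sets of size at most `r` preserves the exchange property.
  sparsePaving : Matroid n
  sparsePaving = record
    { Independent  = λ A → ∣ A ∣ ≤ r × ¬ Bad A
    ; independent? = λ A → (∣ A ∣ ≤? r) ×-dec ¬? (bad? A)
    ; empty        = subst (_≤ r) (sym (∣⊥∣≡0 n)) z≤n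
                   , λ bad → <⇒≢ 0<r (trans (sym (∣⊥∣≡0 n)) (∣bad∣ bad))
    -- A bad subset of `B` has size `r`, which `B` does not exceed, so it is `B` itself.
    ; hereditary   = λ A⊆B (∣B∣≤r , good) → ≤-trans (p⊆q⇒∣p∣≤∣q∣ A⊆B) ∣B∣≤r
                   , λ bad → good (subst Bad
                       (⊆∧∣q∣≤∣p∣⇒≡ A⊆B (≤-trans ∣B∣≤r (≤-reflexive (sym (∣bad∣ bad))))) bad)
    ; exchange     = exchange
    }
    where
    exchange : ∀ {A B} → ∣ A ∣ ≤ r × ¬ Bad A → ∣ B ∣ ≤ r × ¬ Bad B → ∣ A ∣ < ∣ B ∣ →
               ∃[ e ] e ∈ B × e ∉ A × ∣ A ∪ ⁅ e ⁆ ∣ ≤ r × ¬ Bad (A ∪ ⁅ e ⁆)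
    exchange {A} {B} _ (∣B∣≤r , goodB) A<B with ∣p∣<∣q∣⇒∃∈∉ A<B
    ... | e , e∈B , e∉A with bad? (A ∪ ⁅ e ⁆)
    ...   | no good = e , e∈B , e∉A
                    , ≤-trans (∣p∪⁅x⁆∣≤1+∣p∣ A e) (≤-trans A<B ∣B∣≤r) , good
    -- If `B` lay inside the bad set, it would equal it by size and be bad. So `B` has an element
    -- `f` outside `A ∪ ⁅ e ⁆`, and since `f` differs from `e`, separation keeps `A ∪ ⁅ f ⁆` from
    -- being bad.
    ...   | yes bad with B ⊆? (A ∪ ⁅ e ⁆)
    ...     | yes B⊆Ae = contradiction (subst Bad (sym B≡Ae) bad) goodB
      where
      B≡Ae : B ≡ A ∪ ⁅ e ⁆
      B≡Ae = ⊆∧∣q∣≤∣p∣⇒≡ B⊆Ae (≤-trans (∣p∪⁅x⁆∣≤1+∣p∣ A e) A<B)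
    ...     | no B⊈Ae with ⊈⇒∃∈∉ B⊈Ae
    ...       | f , f∈B , f∉Ae = f , f∈B , f∉A
                , ≤-trans (∣p∪⁅x⁆∣≤1+∣p∣ A f) (≤-trans A<B ∣B∣≤r)
                , λ bad′ → f∉Ae
                    (subst (_∈ A ∪ ⁅ e ⁆) (separated e∉A f∉A bad bad′) (q⊆p∪q A ⁅ e ⁆ (x∈⁅x⁆ e)))
      where
      f∉A : f ∉ A
      f∉A f∈A = f∉Ae (p⊆p∪q ⁅ e ⁆ f∈A)

-- The i-th pair consists of i ↑ˡ m and m ↑ʳ i.
PartialTransversal : ∀ m → Pred (Subset (m + m)) 0ℓ
PartialTransversal m S = take m S ⊆ ∁ (drop m S)

partialTransversal⇔ : ∀ {m} (X Y : Subset m) → PartialTransversal m (X ++ Y) ⇔ X ⊆ ∁ Y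
partialTransversal⇔ {m} X Y with take m (X ++ Y) | drop m (X ++ Y) | take-drop-++ X Y
... | _ | _ | refl , refl = mk⇔ (λ p → p) (λ p → p)

-- This is the partition matroid of the pairs. For exchange, a partial transversal `X ++ Y` has as
-- many elements as the pairs it meets, which form `X ∪ Y`. A larger one therefore meets a pair that
-- the smaller one misses, and its element of that pair can be added.
pairs : ∀ m → Matroid (m + m)
pairs m = record
  { Independent  = PartialTransversal m
  ; independent? = λ S → take m S ⊆? ∁ (drop m S)
  ; empty        = subst (PartialTransversal m) (sym (⊥-++ m m))
                     (Equivalence.from (partialTransversal⇔ ⊥ ⊥) (⊥⊆))
  ; hereditary   = hereditary
  ; exchange     = exchange
  }
  where
  hereditary : ∀ {A B} → A ⊆ B → PartialTransversal m B → PartialTransversal m A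
  hereditary {A} {B} A⊆B indB with ++-view m A | ++-view m B
  ... | X , Y , refl | X′ , Y′ , refl = Equivalence.from (partialTransversal⇔ X Y)
    λ i∈X → x∉p⇒x∈∁p λ i∈Y →
      x∈p⇒x∉∁p (↑ʳ∈++⁻ X′ (A⊆B (↑ʳ∈++⁺ X i∈Y)))
        (Equivalence.to (partialTransversal⇔ X′ Y′) indB (↑ˡ∈++⁻ Y′ (A⊆B (↑ˡ∈++⁺ Y i∈X))))

  exchange : ∀ {A B} → PartialTransversal m A → PartialTransversal m B → ∣ A ∣ < ∣ B ∣ →
             ∃[ e ] e ∈ B × e ∉ A × PartialTransversal m (A ∪ ⁅ e ⁆)
  exchange {A} {B} indA indB A<B with ++-view m A | ++-view m B
  ... | X , Y , refl | X′ , Y′ , refl with ∣p∣<∣q∣⇒∃∈∉ {p = X ∪ Y} {X′ ∪ Y′} ∣∪∣<∣∪∣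
    where
    ∣∪∣≡∣++∣ : ∀ P Q → PartialTransversal m (P ++ Q) → ∣ P ∪ Q ∣ ≡ ∣ P ++ Q ∣
    ∣∪∣≡∣++∣ P Q ind = trans
      (p⊆∁q⇒∣p∪q∣≡∣p∣+∣q∣ (Equivalence.to (partialTransversal⇔ P Q) ind)) (sym (∣++∣ P Q))
    ∣∪∣<∣∪∣ : ∣ X ∪ Y ∣ < ∣ X′ ∪ Y′ ∣
    ∣∪∣<∣∪∣ = subst₂ _<_ (sym (∣∪∣≡∣++∣ X Y indA)) (sym (∣∪∣≡∣++∣ X′ Y′ indB)) A<B
  ... | i , i∈X′∪Y′ , i∉X∪Y with x∈p∪q⁻ X′ Y′ i∈X′∪Y′
  ...   | inj₁ i∈X′ = i ↑ˡ m , ↑ˡ∈++⁺ Y′ i∈X′ , i∉X∪Y ∘ p⊆p∪q Y ∘ ↑ˡ∈++⁻ Y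
        , subst (PartialTransversal m) (sym (++-∪-⁅↑ˡ⁆ X Y i))
            (Equivalence.from (partialTransversal⇔ _ Y) λ {j} j∈ → x∉p⇒x∈∁p λ j∈Y →
              [ (λ j∈X → x∈p⇒x∉∁p j∈Y (Equivalence.to (partialTransversal⇔ X Y) indA j∈X))
              , (λ j∈i → i∉X∪Y (q⊆p∪q X Y (subst (_∈ Y) (x∈⁅y⁆⇒x≡y i j∈i) j∈Y)))
              ]′ (x∈p∪q⁻ X ⁅ i ⁆ j∈))
  ...   | inj₂ i∈Y′ = m ↑ʳ i , ↑ʳ∈++⁺ X′ i∈Y′ , i∉X∪Y ∘ q⊆p∪q X Y ∘ ↑ʳ∈++⁻ X
        , subst (PartialTransversal m) (sym (++-∪-⁅↑ʳ⁆ X Y i))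
            (Equivalence.from (partialTransversal⇔ X _) λ {j} j∈X → x∉p⇒x∈∁p λ j∈ →
              [ (λ j∈Y → x∈p⇒x∉∁p j∈Y (Equivalence.to (partialTransversal⇔ X Y) indA j∈X))
              , (λ j∈i → i∉X∪Y (p⊆p∪q Y (subst (_∈ X) (x∈⁅y⁆⇒x≡y i j∈i) j∈X)))
              ]′ (x∈p∪q⁻ Y ⁅ i ⁆ j∈))

-- Transversals of the pairs, determined by the set of their left elements

transversal : ∀ {m} → Subset m → Subset (m + m)
transversal X = X ++ ∁ X

toList-injective : ∀ {n} {A B : Subset n} → toList A ≡ toList B → A ≡ B
toList-injective {A = A} {B} eq =
  trans (sym (Vec.cast-is-id refl A)) (Vec.toList-injective refl A B eq)

∣transversal∣ : ∀ {m} (X : Subset m) → ∣ transversal X ∣ ≡ m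
∣transversal∣ X = trans (∣++∣ X (∁ X))
  (trans (cong (_+_ ∣ X ∣) (∣∁p∣≡n∸∣p∣ X)) (m+[n∸m]≡n (∣p∣≤n X)))

transversal-injective : ∀ {m} {X X′ : Subset m} → transversal X ≡ transversal X′ → X ≡ X′
transversal-injective {X = X} {X′} = Vec.++-injectiveˡ X X′

-- A new left element enlarges the left half `P`, a new right element leaves it alone. Hence
-- transversals with equally many left elements cannot arise from one set by adding a left element
-- and a right element respectively.
∣left∣≡1+∣right∣ : ∀ {m} (P Q X X′ : Subset m) i j → i ↑ˡ m ∉ P ++ Q →
                    (P ++ Q) ∪ ⁅ i ↑ˡ m ⁆ ≡ transversal X →
                    (P ++ Q) ∪ ⁅ m ↑ʳ j ⁆ ≡ transversal X′ → ∣ X ∣ ≡ suc ∣ X′ ∣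
∣left∣≡1+∣right∣ P Q X X′ i j i∉ l r = begin-equality
  ∣ X ∣          ≡⟨ cong ∣_∣ (Vec.++-injectiveˡ (P ∪ ⁅ i ⁆) X
                      (trans (sym (++-∪-⁅↑ˡ⁆ P Q i)) l)) ⟨
  ∣ P ∪ ⁅ i ⁆ ∣  ≡⟨ x∉p⇒∣p∪⁅x⁆∣≡1+∣p∣ P i (i∉ ∘ ↑ˡ∈++⁺ Q) ⟩
  suc ∣ P ∣      ≡⟨ cong (suc ∘ ∣_∣) (Vec.++-injectiveˡ P X′
                      (trans (sym (++-∪-⁅↑ʳ⁆ P Q j)) r)) ⟩
  suc ∣ X′ ∣     ∎
  where open ≤-Reasoning

_≟ₛ_ : ∀ {n} (A B : Subset n) → Dec (A ≡ B)
_≟ₛ_ = Vec.≡-dec Bool._≟_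

module _ {m} (k : ℕ) (H : Subset m) where

  -- `H` may have any size: unless it has size `k`, every transversal with `k` left elements is
  -- forbidden.
  Forbidden : Pred (Subset (m + m)) 0ℓ
  Forbidden S = ∃[ X ] ∣ X ∣ ≡ k × X ≢ H × S ≡ transversal X

  forbidden? : Decidable Forbidden
  forbidden? S = anySubset? λ X → (∣ X ∣ ≟ k) ×-dec ¬? (X ≟ₛ H) ×-dec (S ≟ₛ transversal X)

  ∣forbidden∣ : ∀ {S} → Forbidden S → ∣ S ∣ ≡ m
  ∣forbidden∣ (X , _ , _ , refl) = ∣transversal∣ X

  -- If `e` and `f` lie on the same side, the two transversals share their other half, and one half
  -- determines a transversal. If they lie on different sides, the numbers of left elements would
  -- differ by one, although both are `k`.
  forbidden-separated : ∀ {A e f} → e ∉ A → f ∉ A →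
                        Forbidden (A ∪ ⁅ e ⁆) → Forbidden (A ∪ ⁅ f ⁆) → e ≡ f
  forbidden-separated {A} {e} {f} e∉A f∉A (X , ∣X∣ , _ , Ae≡) (X′ , ∣X′∣ , _ , Af≡)
    with ++-view m A | splitFin m m e | splitFin m m f
  ... | P , Q , refl | onLeft i | onLeft j =
    ∪⁅⁆-injective e∉A (trans Ae≡ (trans (cong transversal X≡X′) (sym Af≡)))
    where
    X≡X′ : X ≡ X′
    X≡X′ = ∁-injective (trans
      (sym (Vec.++-injectiveʳ (P ∪ ⁅ i ⁆) X (trans (sym (++-∪-⁅↑ˡ⁆ P Q i)) Ae≡)))
      (Vec.++-injectiveʳ (P ∪ ⁅ j ⁆) X′ (trans (sym (++-∪-⁅↑ˡ⁆ P Q j)) Af≡)))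
  ... | P , Q , refl | onRight i | onRight j =
    ∪⁅⁆-injective e∉A (trans Ae≡ (trans (cong transversal X≡X′) (sym Af≡)))
    where
    X≡X′ : X ≡ X′
    X≡X′ = trans
      (sym (Vec.++-injectiveˡ P X (trans (sym (++-∪-⁅↑ʳ⁆ P Q i)) Ae≡)))
      (Vec.++-injectiveˡ P X′ (trans (sym (++-∪-⁅↑ʳ⁆ P Q j)) Af≡))
  ... | P , Q , refl | onLeft i | onRight j =
    contradiction (∣left∣≡1+∣right∣ P Q X X′ i j e∉A Ae≡ Af≡) λ eq → 1+n≢n (trans (sym eq) (trans ∣X∣ (sym ∣X′∣)))
  ... | P , Q , refl | onRight i | onLeft j =
    contradiction (∣left∣≡1+∣right∣ P Q X′ X j i f∉A Af≡ Ae≡) λ eq → 1+n≢n (trans (sym eq) (trans ∣X′∣ (sym ∣X∣)))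

-- Natural numbers as rationals, and weights of subsets

⟦_⟧ : ℕ → ℚ
⟦ n ⟧ = mkℚ (ℤ.+ n) 0 (Coprime.sym (Coprime.1-coprimeTo n))

⟦⟧-homo-+ : ∀ m n → ⟦ m + n ⟧ ≡ ⟦ m ⟧ ℚ.+ ⟦ n ⟧
⟦⟧-homo-+ m n = ℚ.toℚᵘ-injective (ℚᵘ.≃-trans
  (ℚᵘ.*≡* (cong (ℤ._* ℤ.+ 1) (sym (cong₂ ℤ._+_ (ℤ.*-identityʳ (ℤ.+ m)) (ℤ.*-identityʳ (ℤ.+ n))))))
  (ℚᵘ.≃-sym (ℚ.toℚᵘ-homo-+ ⟦ m ⟧ ⟦ n ⟧)))

⟦⟧-mono-≤ : ∀ {m n} → m ≤ n → ⟦ m ⟧ ℚ.≤ ⟦ n ⟧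
⟦⟧-mono-≤ m≤n = ℚ.*≤* (ℤ.*-monoʳ-≤-nonNeg (ℤ.+ 1) (ℤ.+≤+ m≤n))

⟦⟧-mono-< : ∀ {m n} → m < n → ⟦ m ⟧ ℚ.< ⟦ n ⟧
⟦⟧-mono-< m<n = ℚ.*<* (ℤ.*-monoʳ-<-pos (ℤ.+ 1) (ℤ.+<+ m<n))

⟦⟧-cancel-≤ : ∀ {m n} → ⟦ m ⟧ ℚ.≤ ⟦ n ⟧ → m ≤ n
⟦⟧-cancel-≤ ⟦m⟧≤⟦n⟧ = ≮⇒≥ λ n<m → ℚ.<-irrefl refl (ℚ.<-≤-trans (⟦⟧-mono-< n<m) ⟦m⟧≤⟦n⟧)

⟦⟧-cancel-< : ∀ {m n} → ⟦ m ⟧ ℚ.< ⟦ n ⟧ → m < n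
⟦⟧-cancel-< ⟦m⟧<⟦n⟧ = ≰⇒> λ n≤m → ℚ.<-irrefl refl (ℚ.<-≤-trans ⟦m⟧<⟦n⟧ (⟦⟧-mono-≤ n≤m))

_·_ : ∀ {n} → Vec ℕ n → Subset n → ℕ
us · S = Vec.sum (Vec.zipWith (λ u s → if s then u else 0) us S)

-- This moves all computations with costs and weights from the rationals to the natural numbers.
total≡⟦·⟧ : ∀ {n} (us : Vec ℕ n) (S : Subset n) → total (⟦_⟧ ∘ lookup us) S ≡ ⟦ us · S ⟧
total≡⟦·⟧ []       []          = refl
total≡⟦·⟧ (u ∷ us) (false ∷ S) = trans (ℚ.+-identityˡ _) (total≡⟦·⟧ us S)
total≡⟦·⟧ (u ∷ us) (true ∷ S)  =
  trans (cong (⟦ u ⟧ ℚ.+_) (total≡⟦·⟧ us S)) (sym (⟦⟧-homo-+ u (us · S)))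

replicate-· : ∀ {n} a (S : Subset n) → Vec.replicate n a · S ≡ a * ∣ S ∣
replicate-· a []          = sym (*-zeroʳ a)
replicate-· a (false ∷ S) = replicate-· a S
replicate-· a (true ∷ S)  = trans (cong (a +_) (replicate-· a S)) (sym (*-suc a ∣ S ∣))

pairWeights : ∀ m → ℕ → ℕ → Vec ℕ (m + m)
pairWeights m a b = Vec.replicate m a ++ Vec.replicate m b

pairWeights-· : ∀ {m} a b (X Y : Subset m) →
                pairWeights m a b · (X ++ Y) ≡ a * ∣ X ∣ + b * ∣ Y ∣
pairWeights-· {m} a b X Y = begin
  pairWeights m a b · (X ++ Y)                     ≡⟨ cong Vec.sum (Vec.zipWith-++ pick as bs X Y) ⟩
  Vec.sum (Vec.zipWith pick as X ++ Vec.zipWith pick bs Y) ≡⟨ Vec.sum-++ (Vec.zipWith pick as X) ⟩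
  as · X + bs · Y                                  ≡⟨ cong₂ _+_ (replicate-· a X) (replicate-· b Y) ⟩
  a * ∣ X ∣ + b * ∣ Y ∣                            ∎
  where
  open ≡-Reasoning
  pick : ℕ → Bool → ℕ
  pick u s = if s then u else 0
  as bs : Vec ℕ m
  as = Vec.replicate m a
  bs = Vec.replicate m b

lookup-pairWeights-≤ : ∀ {m a b} → b ≤ a → ∀ e → lookup (pairWeights m a b) e ≤ a
lookup-pairWeights-≤ {m} {a} {b} b≤a e with splitFin m m e
... | onLeft i  = ≤-reflexive (trans (Vec.lookup-++ˡ (Vec.replicate m a) _ i) (Vec.lookup-replicate i a))
... | onRight j = ≤-trans (≤-reflexive
  (trans (Vec.lookup-++ʳ (Vec.replicate m a) _ j) (Vec.lookup-replicate j b))) b≤a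

-- Lengths of encodings

length-encodeℕᵇ-suc : ∀ b → length (encodeℕᵇ (ℕᵇ.suc b)) ≤ 2 + length (encodeℕᵇ b)
length-encodeℕᵇ-suc ℕᵇ.zero  = ≤-refl
length-encodeℕᵇ-suc 2[1+ b ] = s≤s (s≤s (length-encodeℕᵇ-suc b))
length-encodeℕᵇ-suc 1+[2 b ] = m≤n+m _ 2

-- Each successor adds at most two bits. A linear bound is crude but enough, because the size of the
-- instance only has to be linear in `m`.
length-encodeℕ : ∀ n → length (encodeℕ n) ≤ suc (2 * n)
length-encodeℕ n rewrite fromℕ≡fromℕ' n = bound n
  where
  bound : ∀ n → length (encodeℕᵇ (ℕᵇ.fromℕ' n)) ≤ suc (2 * n)
  bound zero    = ≤-refl
  bound (suc n) = begin
    length (encodeℕᵇ (ℕᵇ.suc (ℕᵇ.fromℕ' n)))  ≤⟨ length-encodeℕᵇ-suc (ℕᵇ.fromℕ' n) ⟩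
    2 + length (encodeℕᵇ (ℕᵇ.fromℕ' n))       ≤⟨ +-monoʳ-≤ 2 (bound n) ⟩
    2 + suc (2 * n)                           ≡⟨ cong suc (*-suc 2 n) ⟨
    suc (2 * suc n)                           ∎
    where open ≤-Reasoning

length-encode⟦⟧ : ∀ n → length (encodeℚ ⟦ n ⟧) ≤ 5 + 2 * n
length-encode⟦⟧ n = begin
  -- One sign bit, the numerator, and three bits for the denominator 1.
  suc (length (encodeℕ n List.++ encodeℕ 1))  ≡⟨ cong suc (List.length-++ (encodeℕ n)) ⟩
  suc (length (encodeℕ n) + 3)                ≤⟨ s≤s (+-monoˡ-≤ 3 (length-encodeℕ n)) ⟩
  suc (suc (2 * n) + 3)                       ≡⟨ cong (2 +_) (+-comm (2 * n) 3) ⟩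
  5 + 2 * n                                   ∎
  where open ≤-Reasoning

length-encode-pairWeights : ∀ {m} a b → b ≤ a → ∀ e →
                            length (encodeℚ ⟦ lookup (pairWeights m a b) e ⟧) ≤ 5 + 2 * a
length-encode-pairWeights {m} a b b≤a e = ≤-trans
  (length-encode⟦⟧ (lookup (pairWeights m a b) e))
  (+-monoʳ-≤ 5 (*-monoʳ-≤ 2 (lookup-pairWeights-≤ {m} b≤a e)))

length-concat-tabulate : ∀ {A : Set} {n} b (f : Fin n → List A) → (∀ i → length (f i) ≤ b) →
                         length (List.concat (List.tabulate f)) ≤ n * b
length-concat-tabulate {n = zero}  b f f≤b = z≤n
length-concat-tabulate {n = suc n} b f f≤b = ≤-trans
  (≤-reflexive (List.length-++ (f zero)))
  (+-mono-≤ (f≤b zero) (length-concat-tabulate b (f ∘ suc) (f≤b ∘ suc)))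

-- Instances hiding a solution

module _ {m} (0<m : 0 < m) (k : ℕ) where

  hidden : Subset m → Instance
  hidden H = record
    { M₁       = sparsePaving m 0<m (Forbidden k H) (forbidden? k H) (∣forbidden∣ k H)
                   (forbidden-separated k H)
    ; M₂       = pairs m
    ; v        = ⟦_⟧ ∘ lookup (pairWeights m 1 0)
    ; w        = ⟦_⟧ ∘ lookup (pairWeights m 2 1)
    ; v-nonNeg = λ e → ⟦⟧-mono-≤ z≤n
    ; w-nonNeg = λ e → ⟦⟧-mono-≤ z≤n
    ; L        = ⟦ m + k ⟧
    ; L-nonNeg = ⟦⟧-mono-≤ z≤n
    }

  module _ (H : Subset m) where
    open Instance (hidden H) using (v; w; L)

    total-v : ∀ (X Y : Subset m) → total v (X ++ Y) ≡ ⟦ ∣ X ∣ ⟧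
    total-v X Y = trans (total≡⟦·⟧ (pairWeights m 1 0) (X ++ Y)) (cong ⟦_⟧
      (trans (pairWeights-· 1 0 X Y) (trans (+-identityʳ _) (+-identityʳ _))))

    total-w : ∀ (X Y : Subset m) → total w (X ++ Y) ≡ ⟦ ∣ X ∣ + (∣ X ∣ + ∣ Y ∣) ⟧
    total-w X Y = trans (total≡⟦·⟧ (pairWeights m 2 1) (X ++ Y)) (cong ⟦_⟧
      (trans (pairWeights-· 2 1 X Y) (rearrange ∣ X ∣ ∣ Y ∣)))
      where
      rearrange : ∀ x y → 2 * x + 1 * y ≡ x + (x + y)
      rearrange = solve-∀

    -- The weight is `∣ X ∣` plus the size of the set, and that size is at most `m` for a partial
    -- transversal. A weight of `m + k` thus needs `k` left elements.
    feasible⇒∣X∣≥k : ∀ (X Y : Subset m) → Feasible (hidden H) (X ++ Y) → k ≤ ∣ X ∣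
    feasible⇒∣X∣≥k X Y (_ , ind₂ , L≤w) = +-cancelʳ-≤ m k ∣ X ∣ (begin
      k + m                    ≡⟨ +-comm k m ⟩
      m + k                    ≤⟨ ⟦⟧-cancel-≤ (subst (L ℚ.≤_) (total-w X Y) L≤w) ⟩
      ∣ X ∣ + (∣ X ∣ + ∣ Y ∣)  ≤⟨ +-monoʳ-≤ ∣ X ∣ (p⊆∁q⇒∣p∣+∣q∣≤n
                                    (Equivalence.to (partialTransversal⇔ X Y) ind₂)) ⟩
      ∣ X ∣ + m                ∎)
      where open ≤-Reasoning

    -- The cost leaves exactly `k` left elements, and the weight then requires at least `m ∸ k`
    -- right ones. Being disjoint from `X`, the right half is its whole complement. Among such
    -- transversals only that of `H` is independent in the first matroid.
    feasible∧v<1+k⇒≡transversal : ∀ {S} → Feasible (hidden H) S → total v S ℚ.< ⟦ suc k ⟧ →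
                                S ≡ transversal H
    feasible∧v<1+k⇒≡transversal {S} feas@((_ , ¬forbidden) , ind₂ , L≤w) v<1+k with ++-view m S
    ... | X , Y , refl = conclude (X ≟ₛ H)
      where
      open ≤-Reasoning
      X⊆∁Y : X ⊆ ∁ Y
      X⊆∁Y = Equivalence.to (partialTransversal⇔ X Y) ind₂
      ∣X∣≡k : ∣ X ∣ ≡ k
      ∣X∣≡k = ≤-antisym (s≤s⁻¹ (⟦⟧-cancel-< (subst (ℚ._< ⟦ suc k ⟧) (total-v X Y) v<1+k)))
                        (feasible⇒∣X∣≥k X Y feas)
      m≤∣X∣+∣Y∣ : m ≤ ∣ X ∣ + ∣ Y ∣
      m≤∣X∣+∣Y∣ = +-cancelˡ-≤ k m (∣ X ∣ + ∣ Y ∣) (begin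
        k + m                    ≡⟨ +-comm k m ⟩
        m + k                    ≤⟨ ⟦⟧-cancel-≤ (subst (L ℚ.≤_) (total-w X Y) L≤w) ⟩
        ∣ X ∣ + (∣ X ∣ + ∣ Y ∣)  ≡⟨ cong (_+ (∣ X ∣ + ∣ Y ∣)) ∣X∣≡k ⟩
        k + (∣ X ∣ + ∣ Y ∣)      ∎)
      Y≡∁X : Y ≡ ∁ X
      Y≡∁X = ⊆∧∣q∣≤∣p∣⇒≡ (λ i∈Y → x∉p⇒x∈∁p λ i∈X → x∈p⇒x∉∁p i∈Y (X⊆∁Y i∈X)) (begin
        ∣ ∁ X ∣    ≡⟨ ∣∁p∣≡n∸∣p∣ X ⟩
        m ∸ ∣ X ∣  ≤⟨ m≤n+o⇒m∸n≤o m ∣ X ∣ m≤∣X∣+∣Y∣ ⟩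
        ∣ Y ∣      ∎)
      conclude : Dec (X ≡ H) → X ++ Y ≡ transversal H
      conclude (yes refl) = cong (X ++_) Y≡∁X
      conclude (no X≢H)   =
        contradiction (X , ∣X∣≡k , X≢H , cong (X ++_) Y≡∁X) ¬forbidden

    transversal-feasible : ∣ H ∣ ≡ k → Feasible (hidden H) (transversal H)
    transversal-feasible ∣H∣≡k =
        (≤-reflexive (∣transversal∣ H) , λ (X , _ , X≢H , eq) → X≢H (sym (transversal-injective eq)))
      , Equivalence.from (partialTransversal⇔ H (∁ H)) (λ i∈H → x∉p⇒x∈∁p (x∈p⇒x∉∁p i∈H))
      , subst (L ℚ.≤_) (sym (total-w H (∁ H))) (⟦⟧-mono-≤ (≤-reflexive (begin-equality
          m + k                      ≡⟨ +-comm m k ⟩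
          k + m                      ≡⟨ cong₂ _+_ ∣H∣≡k (trans (sym (∣++∣ H (∁ H))) (∣transversal∣ H)) ⟨
          ∣ H ∣ + (∣ H ∣ + ∣ ∁ H ∣)  ∎)))
      where open ≤-Reasoning

    hidden-OPT : ∣ H ∣ ≡ k → IsOPT (hidden H) ⟦ k ⟧
    hidden-OPT ∣H∣≡k =
      (transversal H , transversal-feasible ∣H∣≡k
        , trans (total-v H (∁ H)) (cong ⟦_⟧ ∣H∣≡k))
      , λ S feas → lower S feas
      where
      lower : ∀ S → Feasible (hidden H) S → ⟦ k ⟧ ℚ.≤ total v S
      lower S feas with ++-view m S
      ... | X , Y , refl = subst (⟦ k ⟧ ℚ.≤_) (sym (total-v X Y)) (⟦⟧-mono-≤ (feasible⇒∣X∣≥k X Y feas))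

    length-encodeInstance : length (encodeInstance (hidden H)) ≤ 38 * m + 2 * k + 6
    length-encodeInstance = begin
      length (encodeInstance (hidden H))
        ≡⟨ trans (List.length-++ (encodeℕ (m + m))) (cong (length (encodeℕ (m + m)) +_)
             (List.length-++ (List.concat (List.tabulate entry)))) ⟩
      length (encodeℕ (m + m)) + (length (List.concat (List.tabulate entry)) + length (encodeℚ L))
        ≤⟨ +-mono-≤ (length-encodeℕ (m + m)) (+-mono-≤ (length-concat-tabulate 16 entry length-entry)
             (length-encode⟦⟧ (m + k))) ⟩
      suc (2 * (m + m)) + ((m + m) * 16 + (5 + 2 * (m + k)))
        ≡⟨ collect m k ⟩
      38 * m + 2 * k + 6 ∎
      where
      open ≤-Reasoning
      entry : Fin (m + m) → Word
      entry e = encodeℚ (v e) List.++ encodeℚ (w e)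
      -- At most `5 + 2 * 1` bits for the cost and `5 + 2 * 2` for the weight.
      length-entry : ∀ e → length (entry e) ≤ 16
      length-entry e = begin
        length (entry e)                              ≡⟨ List.length-++ (encodeℚ (v e)) ⟩
        length (encodeℚ (v e)) + length (encodeℚ (w e))
          ≤⟨ +-mono-≤ (length-encode-pairWeights {m} 1 0 z≤n e)
                      (length-encode-pairWeights {m} 2 1 (s≤s z≤n) e) ⟩
        16 ∎
      collect : ∀ m k → suc (2 * (m + m)) + ((m + m) * 16 + (5 + 2 * (m + k))) ≡ 38 * m + 2 * k + 6
      collect = solve-∀

-- The adversary argument

module _ {o} (M : Machine o) (O : Oracles o) where
  open Machine M

  queries : ℕ → Fin states → Vec Tape (suc workTapes) → List Word
  queries zero    q ts = []
  queries (suc t) q ts with δ q (Vec.map Tape.head ts)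
  ... | halt        = []
  ... | step q′ as  = queries t q′ (Vec.zipWith writeMove as ts)
  ... | ask j i p r = let x = wordAtHead (lookup ts i) in
                      x ∷ queries t (if O j x then p else r) ts

  length-queries : ∀ t q ts → length (queries t q ts) ≤ t
  length-queries zero    q ts = z≤n
  length-queries (suc t) q ts with δ q (Vec.map Tape.head ts)
  ... | halt        = z≤n
  ... | step q′ as  = m≤n⇒m≤1+n (length-queries t q′ (Vec.zipWith writeMove as ts))
  ... | ask j i p r =
    s≤s (length-queries t (if O j (wordAtHead (lookup ts i)) then p else r) ts)

  -- The output is included because a machine may output a word it never asked about.
  seen : ℕ → Fin states → Vec Tape (suc workTapes) → List Word
  seen t q ts = fromMaybe (run M O t q ts) List.++ queries t q ts

  length-seen : ∀ t q ts → length (seen t q ts) ≤ suc t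
  length-seen t q ts with run M O t q ts
  ... | nothing = m≤n⇒m≤1+n (length-queries t q ts)
  ... | just _  = s≤s (length-queries t q ts)

  -- The oracle influences a run only through the answers received, so agreement on the words
  -- queried in the run with `O` keeps both runs in the same configurations.
  run-cong : (O′ : Oracles o) → ∀ t q ts →
             (∀ j {x} → x List∈ queries t q ts → O j x ≡ O′ j x) →
             run M O t q ts ≡ run M O′ t q ts
  run-cong O′ zero    q ts agree with δ q (Vec.map Tape.head ts)
  ... | halt        = refl
  ... | step _ _    = refl
  ... | ask _ _ _ _ = refl
  run-cong O′ (suc t) q ts agree with δ q (Vec.map Tape.head ts)
  ... | halt        = refl
  ... | step q′ as  = run-cong O′ t q′ (Vec.zipWith writeMove as ts) agree
  ... | ask j i p r = trans
    (run-cong O′ t (if O j (wordAtHead (lookup ts i)) then p else r) ts (λ j → agree j ∘ there))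
    (cong (λ b → run M O′ t (if b then p else r) ts) (agree j (here refl)))

  -- Oracles that differ at most at `w` give the same run as long as `w` is not queried. An output
  -- `w` would then also be the output under `O`, and so be seen.
  unseen⇒not-output : ∀ {t q ts w} (O′ : Oracles o) → (∀ j x → x ≢ w → O j x ≡ O′ j x) →
                      w List∉ seen t q ts → run M O′ t q ts ≢ just w
  unseen⇒not-output {t} {q} {ts} {w} O′ agree w∉ outputs = w∉ (∈-++⁺ˡ
    (subst (λ r → w List∈ fromMaybe r) (sym same-run) (here refl)))
    where
    same-run : run M O t q ts ≡ just w
    same-run = trans
      (run-cong O′ t q ts λ j {x} x∈ → agree j x λ x≡w →
        w∉ (∈-++⁺ʳ (fromMaybe (run M O t q ts)) (subst (_List∈ queries t q ts) x≡w x∈)))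
      outputs

independenceOracle-cong : ∀ {n} (M M′ : Matroid n) S₀ →
  (∀ S → S ≢ S₀ → Matroid.Independent M S ⇔ Matroid.Independent M′ S) →
  ∀ x → x ≢ toList S₀ → independenceOracle M x ≡ independenceOracle M′ x
independenceOracle-cong {n} M M′ S₀ same x x≢ with length x ≟ n
... | no  _    = refl
... | yes refl = trans (isYes≗does (Matroid.independent? M S)) (trans
  (does-⇔ (same S S≢S₀) (Matroid.independent? M S) (Matroid.independent? M′ S))
  (sym (isYes≗does (Matroid.independent? M′ S))))
  where
  S : Subset (length x)
  S = fromList x
  S≢S₀ : S ≢ S₀
  S≢S₀ eq = x≢ (trans (sym (Vec.toList∘fromList x)) (cong toList eq))

-- The empty set has the wrong size, so hiding it hides nothing.
hidden-agree : ∀ {m} (0<m : 0 < m) {k} → 0 < k → ∀ H j x → x ≢ toList (transversal H) →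
               instanceOracles (hidden 0<m k ⊥) j x ≡ instanceOracles (hidden 0<m k H) j x
hidden-agree         0<m     0<k H (suc _) x x≢ = refl
hidden-agree {m} 0<m {k} 0<k H zero    x x≢ =
  independenceOracle-cong (Instance.M₁ (hidden 0<m k ⊥)) (Instance.M₁ (hidden 0<m k H))
    (transversal H) (λ S S≢ → mk⇔
      (λ (∣S∣≤m , ok) → ∣S∣≤m , λ (X , ∣X∣≡k , _ , S≡) → ok (X , ∣X∣≡k , ≢⊥ ∣X∣≡k , S≡))
      (λ (∣S∣≤m , ok) → ∣S∣≤m , λ (X , ∣X∣≡k , _ , S≡) →
        ok (X , ∣X∣≡k , (λ X≡H → S≢ (trans S≡ (cong transversal X≡H))) , S≡)))
    x x≢
  where
  ≢⊥ : ∀ {X : Subset m} → ∣ X ∣ ≡ k → X ≢ ⊥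
  ≢⊥ ∣X∣≡k refl = <⇒≢ 0<k (trans (sym (∣⊥∣≡0 m)) ∣X∣≡k)

-- A large family of `k`-sets

-- The index is read as `k` digits in base `N`, each of which selects one element of a block of size
-- `N`. This yields `N ^ k` different `k`-sets without any estimate of binomial coefficients.
choice : ∀ {N} k → Fin (N ^ k) → Subset (k * N)
choice     zero    i = []
choice {N} (suc k) i = let q , r = remQuot (N ^ k) i in ⁅ q ⁆ ++ choice k r

∣choice∣ : ∀ {N} k (i : Fin (N ^ k)) → ∣ choice k i ∣ ≡ k
∣choice∣     zero    i = refl
∣choice∣ {N} (suc k) i = let q , r = remQuot {N} (N ^ k) i in
  trans (∣++∣ ⁅ q ⁆ (choice k r)) (cong₂ _+_ (∣⁅x⁆∣≡1 q) (∣choice∣ k r))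

⁅⁆-injective : ∀ {n} {x y : Fin n} → ⁅ x ⁆ ≡ ⁅ y ⁆ → x ≡ y
⁅⁆-injective {x = x} {y} eq = x∈⁅y⁆⇒x≡y y (subst (x ∈_) eq (x∈⁅x⁆ x))

choice-injective : ∀ {N} k {i j : Fin (N ^ k)} → choice k i ≡ choice k j → i ≡ j
choice-injective     zero    {zero} {zero} _ = refl
choice-injective {N} (suc k) {i} {j} eq = begin
  i                                ≡⟨ Fin.combine-remQuot {N} (N ^ k) i ⟨
  combine (proj₁ (split i)) (proj₂ (split i))
    ≡⟨ cong₂ combine (⁅⁆-injective (Vec.++-injectiveˡ ⁅ proj₁ (split i) ⁆ ⁅ proj₁ (split j) ⁆ eq))
         (choice-injective k (Vec.++-injectiveʳ ⁅ proj₁ (split i) ⁆ ⁅ proj₁ (split j) ⁆ eq)) ⟩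
  combine (proj₁ (split j)) (proj₂ (split j))
    ≡⟨ Fin.combine-remQuot {N} (N ^ k) j ⟩
  j                                ∎
  where
  open ≡-Reasoning
  split : Fin (N * N ^ k) → Fin N × Fin (N ^ k)
  split = remQuot (N ^ k)

-- Otherwise the positions of the words `f i` in `xs` would embed `Fin n` into fewer than `n`
-- places.
∃∉ : ∀ {n} (f : Fin n → Word) → (∀ {i j} → f i ≡ f j → i ≡ j) →
     ∀ xs → length xs < n → ∃[ i ] f i List∉ xs
∃∉ {n} f f-injective xs xs<n = Fin.¬∀⟶∃¬ n (λ i → f i List∈ xs) (λ i → f i ∈ʷ? xs) ¬all
  where
  ¬all : ¬ (∀ i → f i List∈ xs)
  ¬all all with Fin.pigeonhole xs<n (Any.index ∘ all)
  ... | i , j , i<j , eq = Fin.<⇒≢ i<j (f-injective (begin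
    f i                               ≡⟨ lookup-index (all i) ⟩
    List.lookup xs (Any.index (all i)) ≡⟨ cong (List.lookup xs) eq ⟩
    List.lookup xs (Any.index (all j)) ≡⟨ lookup-index (all j) ⟨
    f j                               ∎))
    where open ≡-Reasoning

-- The number of candidates against the running time

^-distribʳ-* : ∀ a b c → (a * b) ^ c ≡ a ^ c * b ^ c
^-distribʳ-* a b zero    = refl
^-distribʳ-* a b (suc c) = trans (cong (a * b *_) (^-distribʳ-* a b c)) (swap a b (a ^ c) (b ^ c))
  where
  swap : ∀ a b x y → a * b * (x * y) ≡ a * x * (b * y)
  swap = solve-∀

-- One factor `N` outweighs the constant `G * D ^ c`, and the other `c` factors match the growth of
-- `l ^ c`. The summand 2 in `N` pays for the one extra word in `seen` and for strictness.
time<choices : ∀ G D c {l} → let N = 2 + G * D ^ c in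
               l ≤ D * N → suc (G * l ^ c) < N ^ suc c
time<choices G D c {l} l≤DN = begin
  2 + G * l ^ c                          ≤⟨ +-monoʳ-≤ 2 (*-monoʳ-≤ G (^-monoˡ-≤ c l≤DN)) ⟩
  2 + G * (D * N) ^ c                    ≡⟨ cong (λ y → 2 + G * y) (^-distribʳ-* D N c) ⟩
  2 + G * (D ^ c * N ^ c)                ≡⟨ cong (2 +_) (*-assoc G (D ^ c) (N ^ c)) ⟨
  2 + G * D ^ c * N ^ c                  ≤⟨ +-monoˡ-≤ (G * D ^ c * N ^ c) (*-monoʳ-≤ 2 (m^n>0 N c)) ⟩
  2 * N ^ c + G * D ^ c * N ^ c          ≡⟨ *-distribʳ-+ (N ^ c) 2 (G * D ^ c) ⟨
  N * N ^ c                              ∎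
  where
  open ≤-Reasoning
  N : ℕ
  N = 2 + G * D ^ c

-- With ε the inverse of k + 1, the slack ε k stays below ε (k + 1) = 1. As costs are integral, the
-- approximation has to be optimal.
[1+ε]⟦k⟧<⟦1+k⟧ : ∀ k → (1ℚ ℚ.+ 1/ ⟦ suc k ⟧) ℚ.* ⟦ k ⟧ ℚ.< ⟦ suc k ⟧
[1+ε]⟦k⟧<⟦1+k⟧ k = begin-strict
  (1ℚ ℚ.+ ε) ℚ.* ⟦ k ⟧          ≡⟨ ℚ.*-distribʳ-+ ⟦ k ⟧ 1ℚ ε ⟩
  1ℚ ℚ.* ⟦ k ⟧ ℚ.+ ε ℚ.* ⟦ k ⟧  ≡⟨ cong (ℚ._+ ε ℚ.* ⟦ k ⟧) (ℚ.*-identityˡ ⟦ k ⟧) ⟩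
  ⟦ k ⟧ ℚ.+ ε ℚ.* ⟦ k ⟧         <⟨ ℚ.+-monoʳ-< ⟦ k ⟧ (ℚ.*-monoʳ-<-pos ε (⟦⟧-mono-< (n<1+n k))) ⟩
  ⟦ k ⟧ ℚ.+ ε ℚ.* ⟦ suc k ⟧     ≡⟨ cong (⟦ k ⟧ ℚ.+_) (ℚ.*-inverseˡ ⟦ suc k ⟧) ⟩
  ⟦ k ⟧ ℚ.+ ⟦ 1 ⟧               ≡⟨ ⟦⟧-homo-+ k 1 ⟨
  ⟦ k + 1 ⟧                     ≡⟨ cong ⟦_⟧ (+-comm k 1) ⟩
  ⟦ suc k ⟧                     ∎
  where
  open ℚ.≤-Reasoning
  ε : ℚ
  ε = 1/ ⟦ suc k ⟧

no-EPTAS : ¬ MIC-EPTAS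
no-EPTAS A = refute (approximates ε (I H) ⟦ k ⟧ (hidden-OPT 0<m k H (∣choice∣ k index)))
  where
  open MIC-EPTAS A
  open Machine machine using (states; workTapes; start)
  k D G N m : ℕ
  ε : ℚ
  -- One more than the exponent of the running time, so that the `N ^ k` candidates outnumber the
  -- steps. `ε`, `G` and `D` are fixed by `k`, and `N` is chosen after them.
  k = suc c
  ε = 1/ ⟦ suc k ⟧
  G = g (1/ ε)
  -- With `m = k * N`, the size bound `38 * m + 2 * k + 6` is at most `D * N`.
  D = 40 * k + 6
  N = 2 + G * D ^ c
  m = k * N

  0<m : 0 < m
  0<m = s≤s z≤n

  I : Subset m → Instance
  I = hidden 0<m k

  -- The encoding does not mention the matroids, so all instances `I H` have the same input word and
  -- time bound by computation.
  time : ℕ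
  time = G * length (encodeInstance (I ⊥)) ^ c

  initial : Vec Tape (suc workTapes)
  initial = inputTape (encodeℚ ε List.++ encodeInstance (I ⊥)) ∷ Vec.replicate workTapes blankTape

  size : length (encodeInstance (I ⊥)) ≤ D * N
  size = begin
    length (encodeInstance (I ⊥))     ≤⟨ length-encodeInstance 0<m k ⊥ ⟩
    38 * (k * N) + 2 * k + 6          ≤⟨ +-mono-≤ (+-monoʳ-≤ (38 * (k * N)) (m≤m*n (2 * k) N)) (m≤m*n 6 N) ⟩
    38 * (k * N) + 2 * k * N + 6 * N  ≡⟨ collect k N ⟩
    D * N                             ∎
    where
    open ≤-Reasoning
    collect : ∀ k N → 38 * (k * N) + 2 * k * N + 6 * N ≡ (40 * k + 6) * N
    collect = solve-∀

  -- The reference run is on `I ⊥`, where every candidate is forbidden. Within `time` steps it sees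
  -- at most `suc time` words, fewer than there are candidates; one that it misses becomes the
  -- hidden solution.
  unseen : ∃[ i ] toList (transversal (choice k i)) List∉
                  seen machine (instanceOracles (I ⊥)) time start initial
  unseen = ∃∉ (toList ∘ transversal ∘ choice k)
    (choice-injective k ∘ transversal-injective ∘ toList-injective)
    (seen machine (instanceOracles (I ⊥)) time start initial)
    (≤-<-trans (length-seen machine (instanceOracles (I ⊥)) time start initial)
               (time<choices G D c size))

  index : Fin (N ^ k)
  index = proj₁ unseen

  H : Subset m
  H = choice k index

  refute : ¬ (∃[ S ] run machine (instanceOracles (I H)) time start initial ≡ just (toList S)
                     × Feasible (I H) S
                     × total (Instance.v (I H)) S ℚ.≤ (1ℚ ℚ.+ ε) ℚ.* ⟦ k ⟧)
  refute (S , outputs , feasible , v≤) =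
    unseen⇒not-output machine (instanceOracles (I ⊥)) (instanceOracles (I H))
      (hidden-agree 0<m (s≤s z≤n) H) (proj₂ unseen)
      (trans outputs (cong (just ∘ toList)
        (feasible∧v<1+k⇒≡transversal 0<m k H feasible (ℚ.≤-<-trans v≤ ([1+ε]⟦k⟧<⟦1+k⟧ k)))))

theorem3p1 : MIC-EPTAS → W[ 1 ] ≐ FPT
theorem3p1 = ⊥-elim ∘ no-EPTAS
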